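{- Let $h$ be a positive integer, let $A$ be an asymptotic basis with $G(A)\le h$, and let $X$ be a nonempty finite subset of $A$ such that $G(A\setminus X)<\infty$. Let $\mu=\mu(A,X)=\min_{y\in A\setminus X}\mathrm{diam}(X\cup\{y\})$. Then $$G(A\setminus X)\le 4h(2h\mu+1).$$
   Context: A set $A\subseteq\mathbb{Z}$ with $|A\cap\mathbb{Z}_{<0}|<\infty$ is an asymptotic basis if for some positive integer $h$ the $h$-fold sumset $hA=\{a_1+\dots+a_h: a_i\in A\}$ contains all but finitely many non-negative integers; the least such $h$ is the order $G(A)$ (and $G(A)=\infty$ if no such $h$ exists). For a finite set $Y$ of integers, $\mathrm{diam}(Y)=\max Y-\min Y$. -}

module Defs where

open import Level using (Level; _⊔_)
open import Data.Nat.Base as ℕ using (ℕ)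
open import Data.Integer.Base using (ℤ; +_; 0ℤ; _<_; _-_; ∣_∣)
open import Data.Integer.Properties using (≤-totalOrder; +-0-monoid)
open import Data.Fin.Base using (Fin)
open import Data.List.Base using (List)
open import Data.List.NonEmpty.Base using (List⁺; _∷_; _∷⁺_; toList)
import Data.List.Membership.Propositional as List
open import Data.List.Extrema ≤-totalOrder using (max; min)
open import Data.Product.Base using (_×_; ∃; ∃-syntax)
open import Algebra.Properties.Monoid.Sum +-0-monoid using (sum)
open import Relation.Unary using (Pred; _∈_; _∉_; _∩_; _⊆_; _∖_)
open import Relation.Binary.PropositionalEquality.Core using (_≡_)

private
  variable
    a ℓ : Level
    C : Set a

-- The list may contain further elements: extracting an exact enumeration of P
-- from it would require membership in P to be decidable.
Finite : {C : Set a} → Pred C ℓ → Set (a ⊔ ℓ)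
Finite {C = C} P = ∃[ xs ] P ⊆ (List._∈ xs)

IsLeast : Pred ℕ ℓ → ℕ → Set ℓ
IsLeast S m = m ∈ S × (∀ n → n ∈ S → m ℕ.≤ n)

infix 8 _·_

_·_ : ℕ → Pred ℤ ℓ → Pred ℤ ℓ
(h · A) n = ∃[ a ] (∀ (i : Fin h) → a i ∈ A) × sum a ≡ n

ContainsAlmostAllℕ : Pred ℤ ℓ → Set ℓ
ContainsAlmostAllℕ S = Finite (λ (n : ℕ) → + n ∉ S)

BasisWith : Pred ℤ ℓ → Pred ℕ ℓ
BasisWith A h = 1 ℕ.≤ h × ContainsAlmostAllℕ (h · A)

IsAsymptoticBasis : Pred ℤ ℓ → Set ℓ
IsAsymptoticBasis A = Finite (A ∩ (_< 0ℤ)) × ∃ (BasisWith A)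

-- G(A) takes values in ℕ ∪ {∞}, and computing it is not effective, so it is
-- given by its graph: IsOrder A g says G(A) = g, and G(A) < ∞ says that such a
-- g exists.
IsOrder : Pred ℤ ℓ → ℕ → Set ℓ
IsOrder A = IsLeast (BasisWith A)

-- max x xs and min x xs take x itself into account, and the difference is
-- nonnegative, so ∣_∣ only converts it to a natural number.
diam : List⁺ ℤ → ℕ
diam (x ∷ xs) = ∣ max x xs - min x xs ∣

-- Finite nonempty sets are given by lists; repetitions are harmless.
⟦_⟧ : List⁺ C → Pred C _
⟦ X ⟧ x = x List.∈ toList X

-- Isμ A X m says μ(A, X) = m.
Isμ : Pred ℤ ℓ → List⁺ ℤ → ℕ → Set ℓ
Isμ A X = IsLeast (λ d → ∃[ y ] y ∈ (A ∖ ⟦ X ⟧) × d ≡ diam (y ∷⁺ X))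

{-# OPTIONS --safe #-}

-- Let y ∈ B = A ∖ X attain μ, put C = g·B − g y ∋ 0 and D = g μ. Exchanging the
-- summands that lie in X for y moves a sum of g elements of A by an offset
-- confined to an interval of length D, so every window of D + 1 consecutive large
-- integers meets C. For a large l ∈ C, the elements of C of size at most about l
-- thus fill at least l/(D + 1) residue classes modulo l, and they generate ℤ/l.
--
-- In ℤ/l, let P have at most l/2 elements. By averaging, some translate of C
-- meets P in at most |C|/2 elements, and following the generators one finds such
-- a translate w + C with w = p − c₀ + c, p ∈ P, c₀, c ∈ C. Then
-- c₀ + (P ∪ (w + C)) ⊆ P + 2C exceeds P by |C|/2. After D such steps starting
-- from C, more than half of the classes are sums of 2D + 1 elements, so by the
-- pigeonhole principle all classes are sums of k = 2(2D + 1) elements. Choosing l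
-- near n/k, n itself is such a sum plus at most k copies of l, so n ∈ 2k·C and
-- n + 2k g y ∈ 2kg·B.
--
-- Membership in A is not decidable, but the claim is a decidable inequality, so
-- finitely many memberships may be decided under a double negation.

module Submission where

open import Defs
open import Level using (Level)
open import Data.Nat.Base using (ℕ; _+_; _*_; _≤_)
open import Data.Integer.Base using (ℤ)
open import Data.List.NonEmpty.Base using (List⁺)
open import Relation.Unary using (Pred; _⊆_; _∖_)

open import Data.Nat.Base using (zero; suc; pred; _∸_; _<_; z≤n; s≤s; NonZero; >-nonZero; >-nonZero⁻¹)
open import Data.Nat.DivMod using (_/_; _%_; m≡m%n+[m/n]*n; m%n<n; m/n*n≤m; /-monoˡ-≤; m*n/n≡m)
open import Data.Nat.ListAction using (sum)
import Data.Nat.Properties as ℕ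
open import Data.Nat.Tactic.RingSolver using () renaming (solve-∀ to ℕ-solve-∀)
open import Data.Integer.Base as ℤ using (+_; -[1+_]; 0ℤ; 1ℤ)
open import Data.Integer.DivMod using (_%ℕ_; _/ℕ_; n%ℕd<d; a≡a%ℕn+[a/ℕn]*n)
import Data.Integer.Properties as ℤ
open import Data.Integer.Tactic.RingSolver using (solve-∀)
open import Data.Bool.Base using (Bool; true; false; T; _∧_; _∨_; if_then_else_)
open import Data.Bool.Properties using (T-∨; T-∧; ∧-comm)
open import Data.Fin.Base as Fin using (Fin; zero; suc; toℕ; fromℕ; inject₁; opposite)
open import Data.Fin.Permutation using (reverse)
import Data.Fin.Properties as Fin
open import Data.List.Base using (_∷_; upTo)
open import Data.List.Extrema ℤ.≤-totalOrder using (max; min; min≤⊤; min≤xs; ⊥≤max; xs≤max)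
import Data.List.Membership.DecPropositional as DecList
import Data.List.Membership.Propositional as List
open import Data.List.Membership.Propositional.Properties using (∈-upTo⁺)
open import Data.List.NonEmpty.Base using (_∷_; _∷⁺_; toList)
import Data.List.Relation.Unary.All as All
open import Data.List.Relation.Unary.Any using (here; there)
open import Data.Empty using (⊥)
open import Data.Product.Base using (_×_; _,_; ∃; ∃-syntax; proj₁; proj₂)
open import Data.Sum.Base using (_⊎_; inj₁; inj₂)
open import Effect.Monad using (RawMonad)
open import Function.Base using (_∘_)
open import Function.Bundles using (Equivalence; mk⇔)
open import Relation.Nullary using (¬_; Dec; yes; no; contradiction)
open import Relation.Nullary.Decidable using (decidable-stable; does; does-⇔; map′; toWitness; fromWitness; isYes; isYes≗does; ¬¬-excluded-middle)
open import Relation.Nullary.Negation using (¬¬-Monad)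
open import Relation.Unary using (_∈_)
open import Relation.Binary.PropositionalEquality
import Algebra.Properties.Semiring.Sum ℕ.+-*-semiring as ℕ∑

private
  variable
    a ℓ ℓ′ : Level

-- Sums of periodic functions over one period.

sum-mono : ∀ n {f g : Fin n → ℕ} → (∀ i → f i ≤ g i) → ℕ∑.sum f ≤ ℕ∑.sum g
sum-mono zero    f≤g = z≤n
sum-mono (suc n) f≤g = ℕ.+-mono-≤ (f≤g zero) (sum-mono n (f≤g ∘ suc))

sum-const : ∀ n c → ℕ∑.sum {n} (λ _ → c) ≡ n * c
sum-const zero    c = refl
sum-const (suc n) c = cong (λ s → c + s) (sum-const n c)

-- Functions on ℤ/l are represented by periodic functions on ℤ, so that translations need no
-- reduction modulo l.
Periodic : {A : Set a} → ℕ → (ℤ → A) → Set a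
Periodic l f = ∀ x → f (x ℤ.+ + l) ≡ f x

module _ {A : Set a} {l : ℕ} {f : ℤ → A} (per : Periodic l f) where

  shift-periodic : ∀ d → Periodic l (λ x → f (x ℤ.+ d))
  shift-periodic d x = trans (cong f (swap x (+ l) d)) (per (x ℤ.+ d))
    where
    swap : ∀ x l d → x ℤ.+ l ℤ.+ d ≡ x ℤ.+ d ℤ.+ l
    swap = solve-∀

  periodic-sub : ∀ x → f (x ℤ.- + l) ≡ f x
  periodic-sub x = trans (sym (per _)) (cong f (cancel x (+ l)))
    where
    cancel : ∀ x l → x ℤ.- l ℤ.+ l ≡ x
    cancel = solve-∀

∑ : ℕ → (ℤ → ℕ) → ℕ
∑ l f = ℕ∑.sum (λ (i : Fin l) → f (+ toℕ i))

∑-cong : ∀ l {f g : ℤ → ℕ} → f ≗ g → ∑ l f ≡ ∑ l g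
∑-cong l f≗g = ℕ∑.sum-cong-≗ {l} (λ i → f≗g (+ toℕ i))

module _ {l : ℕ} where

  private
    -- Advancing the range by one drops the first value and adds the value one period later, which
    -- is the same.
    ∑-shift-1 : ∀ l {f} → Periodic l f → ∑ l (λ x → f (x ℤ.+ 1ℤ)) ≡ ∑ l f
    ∑-shift-1 zero        per = refl
    ∑-shift-1 (suc l) {f} per = begin
      ∑ (suc l) (λ x → f (x ℤ.+ 1ℤ))
        ≡⟨ ℕ∑.sum-init-last {l} (λ i → f (+ toℕ i ℤ.+ 1ℤ)) ⟩
      ℕ∑.sum (λ (i : Fin l) → f (+ toℕ (inject₁ i) ℤ.+ 1ℤ)) + f (+ toℕ (fromℕ l) ℤ.+ 1ℤ)
        ≡⟨ cong₂ _+_ (ℕ∑.sum-cong-≗ inner) last ⟩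
      ℕ∑.sum (λ (i : Fin l) → f (+ suc (toℕ i))) + f 0ℤ
        ≡⟨ ℕ.+-comm _ (f 0ℤ) ⟩
      ∑ (suc l) f ∎
      where
      open ≡-Reasoning
      inner : ∀ (i : Fin l) → f (+ toℕ (inject₁ i) ℤ.+ 1ℤ) ≡ f (+ suc (toℕ i))
      inner i = cong (λ z → f (+ z)) (trans (ℕ.+-comm _ 1) (cong suc (Fin.toℕ-inject₁ i)))
      last : f (+ toℕ (fromℕ l) ℤ.+ 1ℤ) ≡ f 0ℤ
      last = trans (cong (λ z → f (+ z)) (trans (ℕ.+-comm _ 1) (cong suc (Fin.toℕ-fromℕ l)))) (per 0ℤ)

  private
    ∑-shift-ℕ : ∀ {f} → Periodic l f → ∀ d → ∑ l (λ x → f (x ℤ.+ + d)) ≡ ∑ l f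
    ∑-shift-ℕ {f} per zero    = ∑-cong l (λ x → cong f (ℤ.+-identityʳ x))
    ∑-shift-ℕ {f} per (suc d) = begin
      ∑ l (λ x → f (x ℤ.+ + suc d))        ≡⟨ ∑-cong l (λ x → cong f (sym (ℤ.+-assoc x 1ℤ (+ d)))) ⟩
      ∑ l (λ x → f (x ℤ.+ 1ℤ ℤ.+ + d))     ≡⟨ ∑-shift-1 l (shift-periodic per (+ d)) ⟩
      ∑ l (λ x → f (x ℤ.+ + d))            ≡⟨ ∑-shift-ℕ per d ⟩
      ∑ l f                                ∎
      where open ≡-Reasoning

  ∑-shift : ∀ {f} → Periodic l f → ∀ d → ∑ l (λ x → f (x ℤ.+ d)) ≡ ∑ l f
  ∑-shift     per (+ d)    = ∑-shift-ℕ per d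
  ∑-shift {f} per -[1+ d ] = begin
    ∑ l (λ x → f (x ℤ.+ -[1+ d ]))                ≡⟨ ∑-shift-ℕ (shift-periodic per -[1+ d ]) (suc d) ⟨
    ∑ l (λ x → f (x ℤ.+ + suc d ℤ.+ -[1+ d ]))    ≡⟨ ∑-cong l (λ x → cong f (cancel x (+ suc d))) ⟩
    ∑ l f                                         ∎
    where
    open ≡-Reasoning
    cancel : ∀ x d → x ℤ.+ d ℤ.- d ≡ x
    cancel = solve-∀

  -- Reversing the order of summation replaces i by l - 1 - i, and d - i is congruent to (l - 1 - i)
  -- + (1 + d) modulo l, so the reflection becomes a translation.
  ∑-reflect : ∀ {f} → Periodic l f → ∀ d → ∑ l (λ x → f (d ℤ.- x)) ≡ ∑ l f
  ∑-reflect {f} per d = begin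
    ∑ l (λ x → f (d ℤ.- x))                                              ≡⟨ ℕ∑.sum-cong-≗ opp ⟩
    ℕ∑.sum (λ (i : Fin l) → f (+ toℕ (opposite i) ℤ.+ (1ℤ ℤ.+ d)))       ≡⟨ ℕ∑.sum-permute {l} (λ i → f (+ toℕ i ℤ.+ (1ℤ ℤ.+ d))) reverse ⟨
    ∑ l (λ x → f (x ℤ.+ (1ℤ ℤ.+ d)))                                     ≡⟨ ∑-shift per (1ℤ ℤ.+ d) ⟩
    ∑ l f                                                                ∎
    where
    open ≡-Reasoning
    arith : ∀ o i d → o ℤ.+ (1ℤ ℤ.+ d) ≡ d ℤ.- i ℤ.+ (o ℤ.+ (1ℤ ℤ.+ i))
    arith = solve-∀
    opp : ∀ (i : Fin l) → f (d ℤ.- + toℕ i) ≡ f (+ toℕ (opposite i) ℤ.+ (1ℤ ℤ.+ d))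
    opp i = begin
      f (d ℤ.- + toℕ i)
        ≡⟨ per _ ⟨
      f (d ℤ.- + toℕ i ℤ.+ + l)
        ≡⟨ cong (λ z → f (d ℤ.- + toℕ i ℤ.+ + z)) (ℕ.m∸n+n≡m (Fin.toℕ<n i)) ⟨
      f (d ℤ.- + toℕ i ℤ.+ + (l ∸ suc (toℕ i) + suc (toℕ i)))
        ≡⟨ cong (λ z → f (d ℤ.- + toℕ i ℤ.+ + (z + suc (toℕ i)))) (Fin.opposite-prop i) ⟨
      f (d ℤ.- + toℕ i ℤ.+ + (toℕ (opposite i) + suc (toℕ i)))
        ≡⟨ cong f (arith (+ toℕ (opposite i)) (+ toℕ i) d) ⟨
      f (+ toℕ (opposite i) ℤ.+ (1ℤ ℤ.+ d)) ∎

-- Sumsets, one summand at a time.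

·-cons : {A : Pred ℤ ℓ} → ∀ j {x y} → x ∈ A → y ∈ j · A → (x ℤ.+ y) ∈ suc j · A
·-cons {A = A} j {x} x∈A (a , a∈A , refl) = a′ , a′∈A , refl
  where
  a′ : Fin (suc j) → ℤ
  a′ zero    = x
  a′ (suc i) = a i
  a′∈A : ∀ i → a′ i ∈ A
  a′∈A zero    = x∈A
  a′∈A (suc i) = a∈A i

-- Peeling off the first summand spares later arguments any handling of tuples.
·-rec : {A : Pred ℤ ℓ} (P : ℕ → Pred ℤ ℓ′) → P 0 0ℤ →
        (∀ j {x y} → x ∈ A → y ∈ j · A → P j y → P (suc j) (x ℤ.+ y)) →
        ∀ j {x} → x ∈ j · A → P j x
·-rec P p0 ps zero    (a , a∈A , refl) = p0
·-rec P p0 ps (suc j) (a , a∈A , refl) =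
  ps j (a∈A zero) rest (·-rec P p0 ps j rest)
  where rest = a ∘ suc , a∈A ∘ suc , refl

·-mono : {A : Pred ℤ ℓ} {B : Pred ℤ ℓ′} → A ⊆ B → ∀ j → j · A ⊆ j · B
·-mono A⊆B j (a , a∈A , eq) = a , A⊆B ∘ a∈A , eq

·-+ : {A : Pred ℤ ℓ} → ∀ j k {x y} → x ∈ j · A → y ∈ k · A → (x ℤ.+ y) ∈ (j + k) · A
·-+ {A = A} j k {y = y} x∈ y∈ =
  ·-rec {A = A} (λ j x → (x ℤ.+ y) ∈ (j + k) · A)
    (subst (_∈ k · A) (sym (ℤ.+-identityˡ y)) y∈)
    (λ j {x} {x′} x∈A _ ih → subst (_∈ suc (j + k) · A) (sym (ℤ.+-assoc x x′ y)) (·-cons {A = A} (j + k) x∈A ih))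
    j x∈

-- Counting residue classes.

𝟙 : Bool → ℕ
𝟙 b = if b then 1 else 0

𝟙-∧ : ∀ b c → 𝟙 (b ∧ c) ≡ 𝟙 b * 𝟙 c
𝟙-∧ false c = refl
𝟙-∧ true  c = sym (ℕ.+-identityʳ (𝟙 c))

𝟙-∨ : ∀ b c → 𝟙 (b ∨ c) + 𝟙 (b ∧ c) ≡ 𝟙 b + 𝟙 c
𝟙-∨ false c = ℕ.+-identityʳ (𝟙 c)
𝟙-∨ true  c = refl

T⇒1≤𝟙 : ∀ {b} → T b → 1 ≤ 𝟙 b
T⇒1≤𝟙 {true} _ = s≤s z≤n

count : ℕ → (ℤ → Bool) → ℕ
count l P = ∑ l (𝟙 ∘ P)

count-∨ : ∀ l P Q → count l (λ x → P x ∨ Q x) + count l (λ x → P x ∧ Q x) ≡ count l P + count l Q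
count-∨ l P Q = begin
  count l (λ x → P x ∨ Q x) + count l (λ x → P x ∧ Q x)  ≡⟨ ℕ∑.∑-distrib-+ {l} _ _ ⟨
  ∑ l (λ x → 𝟙 (P x ∨ Q x) + 𝟙 (P x ∧ Q x))              ≡⟨ ∑-cong l (λ x → 𝟙-∨ (P x) (Q x)) ⟩
  ∑ l (λ x → 𝟙 (P x) + 𝟙 (Q x))                          ≡⟨ ℕ∑.∑-distrib-+ {l} _ _ ⟩
  count l P + count l Q                                  ∎
  where open ≡-Reasoning

count>0⇒¬¬∃ : ∀ l P → 0 < count l P → ¬ ¬ (∃[ x ] T (P x))
count>0⇒¬¬∃ l P pos none = ℕ.<⇒≱ pos (begin
  count l P                    ≤⟨ sum-mono l (λ i → 𝟙≤0 (λ p → none (_ , p))) ⟩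
  ℕ∑.sum {l} (λ _ → 0)         ≡⟨ trans (sum-const l 0) (ℕ.*-zeroʳ l) ⟩
  0                            ∎)
  where
  open ℕ.≤-Reasoning
  𝟙≤0 : ∀ {b} → ¬ T b → 𝟙 b ≤ 0
  𝟙≤0 {false} _ = z≤n
  𝟙≤0 {true}  ¬t = contradiction _ ¬t

-- `P` and its reflection n - P have equally many classes, together more than l, so some class lies
-- in both.
∃-complementary : ∀ l {P} → Periodic l P → l < 2 * count l P →
                  ∀ n → ¬ ¬ (∃[ x ] T (P x) × T (P (n ℤ.- x)))
∃-complementary l {P} per large n none = ℕ.<⇒≱ large (begin
  2 * count l P                                     ≡⟨ cong (λ s → count l P + s) (ℕ.+-identityʳ _) ⟩
  count l P + count l P                             ≡⟨ cong (λ s → count l P + s) (∑-reflect (λ x → cong 𝟙 (per x)) n) ⟨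
  count l P + count l (λ x → P (n ℤ.- x))           ≡⟨ ℕ∑.∑-distrib-+ {l} _ _ ⟨
  ∑ l (λ x → 𝟙 (P x) + 𝟙 (P (n ℤ.- x)))             ≤⟨ sum-mono l (λ i → ≤1 (λ p q → none (+ toℕ i , p , q))) ⟩
  ℕ∑.sum {l} (λ _ → 1)                              ≡⟨ trans (sum-const l 1) (ℕ.*-identityʳ l) ⟩
  l                                                 ∎)
  where
  open ℕ.≤-Reasoning
  ≤1 : ∀ {b c} → (T b → ¬ T c) → 𝟙 b + 𝟙 c ≤ 1
  ≤1 {false} {false} _ = z≤n
  ≤1 {false} {true}  _ = s≤s z≤n
  ≤1 {true}  {false} _ = s≤s z≤n
  ≤1 {true}  {true}  ¬tt = contradiction _ (¬tt _)

-- Intersections of `P` with translates of `C`.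

module _ (l : ℕ) (C : ℤ → Bool) where

  -- For periodic `C` and `P` this is the size of (w + C) ∩ P in ℤ/l.
  hits : (ℤ → Bool) → ℤ → ℕ
  hits P w = count l (λ x → C x ∧ P (w ℤ.+ x))

  hits-periodic : ∀ {P} → Periodic l P → Periodic l (hits P)
  hits-periodic {P} perP w = ∑-cong l (λ x → cong (λ b → 𝟙 (C x ∧ b))
    (trans (cong P (swap w (+ l) x)) (perP (w ℤ.+ x))))
    where
    swap : ∀ w l x → w ℤ.+ l ℤ.+ x ≡ w ℤ.+ x ℤ.+ l
    swap = solve-∀

  -- Double counting: a pair of x in `C` and p in `P` contributes to exactly one translate modulo l,
  -- namely w = p - x.
  ∑-hits : ∀ {P} → Periodic l P → ∑ l (hits P) ≡ count l C * count l P
  ∑-hits {P} perP = begin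
    ∑ l (λ w → ∑ l (λ x → 𝟙 (C x ∧ P (w ℤ.+ x))))
      ≡⟨ ∑-cong l (λ w → ∑-cong l {g = λ x → 𝟙 (C x) * 𝟙 (P (w ℤ.+ x))} (λ x → 𝟙-∧ (C x) (P (w ℤ.+ x)))) ⟩
    ∑ l (λ w → ∑ l (λ x → 𝟙 (C x) * 𝟙 (P (w ℤ.+ x))))
      ≡⟨ ℕ∑.∑-comm {l} {l} _ ⟩
    ∑ l (λ x → ∑ l (λ w → 𝟙 (C x) * 𝟙 (P (w ℤ.+ x))))
      ≡⟨ ∑-cong l (λ x → sym (ℕ∑.*-distribˡ-sum {l} (𝟙 (C x)) (λ i → 𝟙 (P (+ toℕ i ℤ.+ x))))) ⟩
    ∑ l (λ x → 𝟙 (C x) * ∑ l (λ w → 𝟙 (P (w ℤ.+ x))))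
      ≡⟨ ∑-cong l (λ x → cong (λ s → 𝟙 (C x) * s) (∑-shift (λ y → cong 𝟙 (perP y)) x)) ⟩
    ∑ l (λ x → 𝟙 (C x) * count l P)
      ≡⟨ ℕ∑.*-distribʳ-sum {l} (count l P) _ ⟨
    count l C * count l P ∎
    where open ≡-Reasoning

  -- On average a translate of C meets P in the proportion count l P / l of its elements.
  ¬hits-always-large : ∀ {P} .{{_ : NonZero l}} → Periodic l P → 2 * count l P ≤ l →
                          ¬ (∀ w → count l C < 2 * hits P w)
  ¬hits-always-large {P} perP small large = ℕ.<⇒≱ (ℕ.*-monoʳ-< l (ℕ.n<1+n c)) (begin
    l * suc c                         ≡⟨ sum-const l (suc c) ⟨
    ℕ∑.sum {l} (λ _ → suc c)          ≤⟨ sum-mono l (λ i → large (+ toℕ i)) ⟩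
    ∑ l (λ w → 2 * hits P w)       ≡⟨ ℕ∑.*-distribˡ-sum {l} 2 _ ⟨
    2 * ∑ l (hits P)               ≡⟨ cong (λ s → 2 * s) (∑-hits perP) ⟩
    2 * (c * count l P)               ≡⟨ swap c (count l P) ⟩
    c * (2 * count l P)               ≤⟨ ℕ.*-monoʳ-≤ c small ⟩
    c * l                             ≡⟨ ℕ.*-comm c l ⟩
    l * c                             ∎)
    where
    open ℕ.≤-Reasoning
    c = count l C
    swap : ∀ c p → 2 * (c * p) ≡ c * (2 * p)
    swap = ℕ-solve-∀

-- Translation-invariant sets and generators of ℤ/l.

_StableUnder_ : Pred ℤ ℓ → ℤ → Set ℓ
I StableUnder d = ∀ x → x ∈ I → (x ℤ.+ d) ∈ I

module _ (l : ℕ) .{{_ : NonZero l}} (I : Pred ℤ ℓ)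
         (up : I StableUnder (+ l)) (down : I StableUnder (ℤ.- + l))
  where

  private
    iterate : ∀ {d} → I StableUnder d → ∀ k → I StableUnder (+ k ℤ.* d)
    iterate {d} step zero    x x∈I = subst I (sym (ℤ.+-identityʳ x)) x∈I
    iterate {d} step (suc k) x x∈I = subst I (rearrange x (+ k) d) (step _ (iterate step k x x∈I))
      where
      rearrange : ∀ x k d → x ℤ.+ k ℤ.* d ℤ.+ d ≡ x ℤ.+ (1ℤ ℤ.+ k) ℤ.* d
      rearrange = solve-∀

    stable-mod : ∀ q → I StableUnder (q ℤ.* + l)
    stable-mod (+ k)    x x∈I = iterate up k x x∈I
    stable-mod -[1+ k ] x x∈I = subst I (flip x (+ suc k) (+ l)) (iterate down (suc k) x x∈I)
      where
      flip : ∀ x k l → x ℤ.+ k ℤ.* (ℤ.- l) ≡ x ℤ.+ (ℤ.- k) ℤ.* l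
      flip = solve-∀

  -- Division of x - w by l leads from w to x by finitely many unit steps followed by a multiple of
  -- l.
  stable-under-1⇒universal : I StableUnder 1ℤ → ∀ w → w ∈ I → ∀ x → x ∈ I
  stable-under-1⇒universal step w w∈I x =
    subst I eq (stable-mod ((x ℤ.- w) /ℕ l) _ (iterate step ((x ℤ.- w) %ℕ l) w w∈I))
    where
    split : ∀ w r q → w ℤ.+ r ℤ.* 1ℤ ℤ.+ q ≡ w ℤ.+ (r ℤ.+ q)
    split = solve-∀
    cancel : ∀ w x → w ℤ.+ (x ℤ.- w) ≡ x
    cancel = solve-∀
    eq : w ℤ.+ + ((x ℤ.- w) %ℕ l) ℤ.* 1ℤ ℤ.+ (x ℤ.- w) /ℕ l ℤ.* + l ≡ x
    eq = trans (split w (+ ((x ℤ.- w) %ℕ l)) _)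
      (trans (cong (λ d → w ℤ.+ d) (sym (a≡a%ℕn+[a/ℕn]*n (x ℤ.- w) l))) (cancel w x))

  -- 1 is congruent to (l − 1) u + (u + 1) modulo l.
  stable-under-consecutive⇒stable-under-1 : ∀ u → I StableUnder u → I StableUnder (u ℤ.+ 1ℤ) →
                                            I StableUnder 1ℤ
  stable-under-consecutive⇒stable-under-1 u step step′ x x∈I =
    subst I (trans (cong (λ n → x ℤ.+ + (l ∸ 1) ℤ.* u ℤ.+ (u ℤ.+ 1ℤ) ℤ.+ (ℤ.- u) ℤ.* + n) (sym (ℕ.m+[n∸m]≡n 1≤l)))
                   (rearrange x (+ (l ∸ 1)) u))
      (stable-mod (ℤ.- u) _ (step′ _ (iterate step (l ∸ 1) x x∈I)))
    where
    1≤l : 1 ≤ l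
    1≤l = >-nonZero⁻¹ l
    rearrange : ∀ x k u → x ℤ.+ k ℤ.* u ℤ.+ (u ℤ.+ 1ℤ) ℤ.+ (ℤ.- u) ℤ.* (1ℤ ℤ.+ k) ≡ x ℤ.+ 1ℤ
    rearrange = solve-∀

-- Translations compose, so it is enough to check stability on the summands.
stable-under-sums : {A : Pred ℤ ℓ} (I : Pred ℤ ℓ′) → (∀ a → a ∈ A → I StableUnder a) →
                    ∀ j s → s ∈ j · A → I StableUnder s
stable-under-sums {A = A} I step j s = ·-rec {A = A} (λ _ s → I StableUnder s)
  (λ x x∈I → subst I (sym (ℤ.+-identityʳ x)) x∈I)
  (λ _ {a} {s} a∈A _ ih x x∈I → subst I (ℤ.+-assoc x a s) (ih _ (step a a∈A x x∈I)))
  j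

-- Growth of sumsets in ℤ/l.

module Growth (l : ℕ) .{{_ : NonZero l}} (C : ℤ → Bool) (perC : Periodic l C) (0∈C : T (C 0ℤ))
              -- Two consecutive integers that are sums of elements of `C` witness that `C`
              -- generates ℤ/l.
              (r : ℕ) (u : ℤ) (u∈ : u ∈ r · (T ∘ C)) (u+1∈ : (u ℤ.+ 1ℤ) ∈ r · (T ∘ C))
  where

  private
    𝐂 : Pred ℤ _
    𝐂 = T ∘ C

  -- Otherwise the translates of C meeting P in more than half of C would be all
  -- translates: a translate w + C that meets P in p = w + c₀ forces this for
  -- w + c = p − c₀ + c, and C generates ℤ modulo l.
  ∃-translate-with-few-hits : ∀ {P} → Periodic l P → ∃ (T ∘ P) → 2 * count l P ≤ l →
    ¬ ¬ (∃[ p ] ∃[ c₀ ] ∃[ c ] T (P p) × 𝐂 c₀ × 𝐂 c × 2 * hits l C P (p ℤ.- c₀ ℤ.+ c) ≤ count l C)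
  ∃-translate-with-few-hits {P} perP (p₀ , p₀∈P) small none =
    ¬hits-always-large l C perP small
      (stable-under-1⇒universal l I up down
        (stable-under-consecutive⇒stable-under-1 l I up down u
          (stable-under-sums I closed r u u∈) (stable-under-sums I closed r _ u+1∈))
        (p₀ ℤ.- 0ℤ ℤ.+ 0ℤ) start)
    where
    I : Pred ℤ _
    I w = count l C < 2 * hits l C P w
    hit : ∀ {p c₀ c} → T (P p) → 𝐂 c₀ → 𝐂 c → I (p ℤ.- c₀ ℤ.+ c)
    hit p∈P c₀∈C c∈C = ℕ.≰⇒> (λ few → none (_ , _ , _ , p∈P , c₀∈C , c∈C , few))
    start : I (p₀ ℤ.- 0ℤ ℤ.+ 0ℤ)
    start = hit p₀∈P 0∈C 0∈C
    up : I StableUnder (+ l)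
    up x = subst (λ h → count l C < 2 * h) (sym (hits-periodic l C perP x))
    down : I StableUnder (ℤ.- + l)
    down x = subst (λ h → count l C < 2 * h) (sym (periodic-sub (hits-periodic l C perP) x))
    cancel : ∀ w c₀ c → w ℤ.+ c₀ ℤ.- c₀ ℤ.+ c ≡ w ℤ.+ c
    cancel = solve-∀
    closed : ∀ c → 𝐂 c → I StableUnder c
    closed c c∈C w w∈I = decidable-stable (_ ℕ.<? _) λ ¬I →
      count>0⇒¬¬∃ l (λ x → C x ∧ P (w ℤ.+ x)) (ℕ.*-cancelˡ-< 2 0 _ (ℕ.≤-<-trans z≤n w∈I))
        λ (c₀ , both) → let (c₀∈C , w+c₀∈P) = Equivalence.to T-∧ both in
          ¬I (subst I (cancel w c₀ c) (hit w+c₀∈P c₀∈C c∈C))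

  -- The invariant of the growth argument: unless `P` already fills more than half of the classes, i
  -- steps have brought it to (1 + i/2)|C| of them. Both bounds are doubled to avoid halves.
  Reaches : ℕ → ℕ → Pred (ℤ → Bool) _
  Reaches i j P = Periodic l P × ∃ (T ∘ P) × (T ∘ P) ⊆ j · 𝐂
                × (l < 2 * count l P ⊎ (2 + i) * count l C ≤ 2 * count l P)

  reaches-start : Reaches 0 1 C
  reaches-start = perC , (0ℤ , 0∈C) , ⊆1 , inj₂ ℕ.≤-refl
    where
    ⊆1 : 𝐂 ⊆ 1 · 𝐂
    ⊆1 {x} x∈C = (λ _ → x) , (λ _ → x∈C) , ℤ.+-identityʳ x

  reaches-step : ∀ {i j P} → Reaches i j P → ¬ ¬ ∃ (Reaches (suc i) (2 + j))
  reaches-step {i} {j} {P} (perP , ne , P⊆ , inj₁ large) k = k (P , perP , ne , P⊆′ , inj₁ large)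
    where
    -- A set that is large enough is kept, and two zeros pad its sums to the new length.
    P⊆′ : (T ∘ P) ⊆ (2 + j) · 𝐂
    P⊆′ {x} x∈P = subst (_∈ (2 + j) · 𝐂) (trans (ℤ.+-identityˡ _) (ℤ.+-identityˡ x))
      (·-cons {A = 𝐂} (suc j) 0∈C (·-cons {A = 𝐂} j 0∈C (P⊆ x∈P)))
  reaches-step {i} {j} {P} (perP , ne@(p₀ , p₀∈P) , P⊆ , inj₂ lower) k with l ℕ.<? 2 * count l P
  ... | yes large = reaches-step {i} (perP , ne , P⊆ , inj₁ large) k
  ... | no ¬large = ∃-translate-with-few-hits perP ne (ℕ.≮⇒≥ ¬large)
    λ (p , c₀ , c , p∈P , c₀∈C , c∈C , few) → k (grown p c₀ c p∈P c₀∈C c∈C few)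
    where
    module _ (p c₀ c : ℤ) (p∈P : T (P p)) (c₀∈C : 𝐂 c₀) (c∈C : 𝐂 c)
             (few : 2 * hits l C P (p ℤ.- c₀ ℤ.+ c) ≤ count l C) where
      w : ℤ
      w = p ℤ.- c₀ ℤ.+ c

      w+C : ℤ → Bool
      w+C x = C (x ℤ.- w)

      per-w+C : Periodic l w+C
      per-w+C = shift-periodic perC (ℤ.- w)

      U : ℤ → Bool
      U x = P x ∨ w+C x

      perU : Periodic l U
      perU x = cong₂ _∨_ (perP x) (per-w+C x)

      -- Translating by c₀ cancels the -c₀ in `w`, so that only sums of elements of `C` remain.
      P′ : ℤ → Bool
      P′ x = U (x ℤ.- c₀)

      count-∩ : count l (λ x → P x ∧ w+C x) ≡ hits l C P w
      count-∩ = trans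
        (sym (∑-shift (λ x → cong₂ (λ b c → 𝟙 (b ∧ c)) (perP x) (per-w+C x)) w))
        (∑-cong l (λ x → cong 𝟙 (trans (∧-comm (P (x ℤ.+ w)) (C (x ℤ.+ w ℤ.- w)))
          (cong₂ (λ y z → C y ∧ P z) (cancel x w) (ℤ.+-comm x w)))))
        where
        cancel : ∀ x w → x ℤ.+ w ℤ.- w ≡ x
        cancel = solve-∀

      count-U : count l U + hits l C P w ≡ count l P + count l C
      count-U = begin
        count l U + hits l C P w                 ≡⟨ cong (λ h → count l U + h) count-∩ ⟨
        count l U + count l (λ x → P x ∧ w+C x)     ≡⟨ count-∨ l P w+C ⟩
        count l P + count l w+C                     ≡⟨ cong (λ s → count l P + s) (∑-shift (λ x → cong 𝟙 (perC x)) (ℤ.- w)) ⟩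
        count l P + count l C                       ∎
        where open ≡-Reasoning

      count-P′ : count l P′ ≡ count l U
      count-P′ = ∑-shift (λ x → cong 𝟙 (perU x)) (ℤ.- c₀)

      -- The union gains |C| less an overlap of at most |C|/2. Adding |C| on both sides avoids
      -- subtraction.
      lower′ : (3 + i) * count l C ≤ 2 * count l P′
      lower′ = ℕ.+-cancelʳ-≤ (count l C) _ _ (begin
        (3 + i) * count l C + count l C                       ≡⟨ expand (count l C) i ⟩
        (2 + i) * count l C + 2 * count l C                   ≤⟨ ℕ.+-monoˡ-≤ _ lower ⟩
        2 * count l P + 2 * count l C                         ≡⟨ ℕ.*-distribˡ-+ 2 (count l P) (count l C) ⟨
        2 * (count l P + count l C)                           ≡⟨ cong (λ s → 2 * s) count-U ⟨
        2 * (count l U + hits l C P w)                     ≡⟨ ℕ.*-distribˡ-+ 2 (count l U) _ ⟩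
        2 * count l U + 2 * hits l C P w                   ≤⟨ ℕ.+-monoʳ-≤ (2 * count l U) few ⟩
        2 * count l U + count l C                             ≡⟨ cong (λ s → 2 * s + count l C) count-P′ ⟨
        2 * count l P′ + count l C                            ∎)
        where
        open ℕ.≤-Reasoning
        expand : ∀ c i → (3 + i) * c + c ≡ (2 + i) * c + 2 * c
        expand = ℕ-solve-∀

      P′⊆ : (T ∘ P′) ⊆ (2 + j) · 𝐂
      P′⊆ {x} x∈P′ with Equivalence.to T-∨ x∈P′
      ... | inj₁ x-c₀∈P = subst (_∈ (2 + j) · 𝐂) (eq x c₀)
              (·-cons {A = 𝐂} (suc j) 0∈C (·-cons {A = 𝐂} j c₀∈C (P⊆ x-c₀∈P)))
        where
        eq : ∀ x c₀ → 0ℤ ℤ.+ (c₀ ℤ.+ (x ℤ.- c₀)) ≡ x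
        eq = solve-∀
      -- Since c₀ + w = p + c, the element x is x - c₀ - w plus c plus p.
      ... | inj₂ rest∈C = subst (_∈ (2 + j) · 𝐂) (eq x p c₀ c)
              (·-cons {A = 𝐂} (suc j) rest∈C (·-cons {A = 𝐂} j c∈C (P⊆ p∈P)))
        where
        eq : ∀ x p c₀ c → x ℤ.- c₀ ℤ.- (p ℤ.- c₀ ℤ.+ c) ℤ.+ (c ℤ.+ p) ≡ x
        eq = solve-∀

      grown : ∃ (Reaches (suc i) (2 + j))
      grown = P′ , shift-periodic perU (ℤ.- c₀) , (p₀ ℤ.+ c₀ , ne′) , (λ {x} → P′⊆ {x}) , inj₂ lower′
        where
        cancel : ∀ x y → x ℤ.+ y ℤ.- y ≡ x
        cancel = solve-∀
        ne′ : T (P′ (p₀ ℤ.+ c₀))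
        ne′ = Equivalence.from T-∨ (inj₁ (subst (T ∘ P) (sym (cancel p₀ c₀)) p₀∈P))

  -- One summand accounts for the initial set `C`, and each step costs two more.
  reaches : ∀ i → ¬ ¬ ∃ (Reaches i (suc (2 * i)))
  reaches zero    k = k (C , reaches-start)
  reaches (suc i) k = reaches i λ (P , ok) → reaches-step {i} {suc (2 * i)} {P} ok
    λ (P′ , ok′) → k (P′ , subst (λ j → Reaches (suc i) j P′) (eq i) ok′)
    where
    eq : ∀ i → 2 + suc (2 * i) ≡ suc (2 * suc i)
    eq = ℕ-solve-∀

  everything-is-a-sum : ∀ D → l ≤ suc D * count l C →
                        ∀ x → ¬ ¬ (x ∈ (suc (2 * D) + suc (2 * D)) · 𝐂)
  everything-is-a-sum D dense x k = reaches D λ (P , perP , _ , P⊆ , large) →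
    ∃-complementary l perP (strict large) x λ (y , y∈P , x-y∈P) →
      k (subst (_∈ (suc (2 * D) + suc (2 * D)) · 𝐂) (cancel y x)
          (·-+ {A = 𝐂} (suc (2 * D)) (suc (2 * D)) (P⊆ y∈P) (P⊆ x-y∈P)))
    where
    cancel : ∀ y x → y ℤ.+ (x ℤ.- y) ≡ x
    cancel = solve-∀
    0<count : 0 < count l C
    0<count = ℕ.*-cancelˡ-< (suc D) 0 _
      (subst (_< suc D * count l C) (sym (ℕ.*-zeroʳ D)) (ℕ.<-≤-trans (>-nonZero⁻¹ l) dense))
    -- (2 + D)|C| exceeds (1 + D)|C|, which is at least l, by the positive number |C|.
    strict : ∀ {s} → l < s ⊎ (2 + D) * count l C ≤ s → l < s
    strict (inj₁ large) = large
    strict (inj₂ bound) = ℕ.<-≤-trans (ℕ.+-mono-<-≤ 0<count dense) bound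

-- Bounds on summands.

term≤sum : ∀ {n} (f : Fin n → ℕ) i → f i ≤ ℕ∑.sum f
term≤sum f zero    = ℕ.m≤m+n (f zero) _
term≤sum f (suc i) = ℕ.≤-trans (term≤sum (f ∘ suc) i) (ℕ.m≤n+m _ (f zero))

pos-∸ : ∀ {m n} → n ≤ m → + m ℤ.- + n ≡ + (m ∸ n)
pos-∸ {m} {n} n≤m = trans (ℤ.m-n≡m⊖n m n) (ℤ.⊖-≥ n≤m)

∣i∣≤n⇒-n≤i≤n : ∀ i {n} → ℤ.∣ i ∣ ≤ n → ℤ.- + n ℤ.≤ i × i ℤ.≤ + n
∣i∣≤n⇒-n≤i≤n (+ _)    i≤n = ℤ.neg-≤-pos , ℤ.+≤+ i≤n
∣i∣≤n⇒-n≤i≤n -[1+ _ ] i≤n = ℤ.neg-mono-≤ (ℤ.+≤+ i≤n) , ℤ.-≤+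

·-multiple : {A : Pred ℤ ℓ} → ∀ {c} → c ∈ A → ∀ j → (+ j ℤ.* c) ∈ j · A
·-multiple         c∈A zero    = (λ ()) , (λ ()) , refl
·-multiple {A = A} {c} c∈A (suc j) =
  subst (_∈ suc j · A) (sym (ℤ.suc-* (+ j) c)) (·-cons {A = A} j c∈A (·-multiple {A = A} c∈A j))

-- The sum of the absolute values is a common bound. Being chosen before l, it lets the generators
-- fit into the window of every modulus.
·-bounded-summands : {A : Pred ℤ ℓ} → ∀ j {x} → x ∈ j · A → ∃[ b ] x ∈ j · (λ c → c ∈ A × ℤ.∣ c ∣ ≤ b)
·-bounded-summands j (c , c∈A , eq) = _ , c , (λ i → c∈A i , term≤sum (ℤ.∣_∣ ∘ c) i) , eq

-- Reduction of a window of `C` modulo l.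

module Window (C : Pred ℤ ℓ) (0∈C : 0ℤ ∈ C) (D N : ℕ)
              (syndetic : ∀ m → N ≤ m → ¬ ¬ (∃[ t ] t ≤ D × (+ m ℤ.- + t) ∈ C))
              (r : ℕ) (u : ℤ) (b : ℕ)
              (u∈ : u ∈ r · (λ c → c ∈ C × ℤ.∣ c ∣ ≤ b))
              (u+1∈ : (u ℤ.+ 1ℤ) ∈ r · (λ c → c ∈ C × ℤ.∣ c ∣ ≤ b))
              (l : ℕ) .{{_ : NonZero l}}
  where

  private
    E : ℕ
    E = N + D + b

  -- The margin E makes room for the offsets N − t, so that no residue class is
  -- lost to boundary effects and C̄-dense is exact.
  W : Pred ℤ _
  W c = c ∈ C × ℤ.- + E ℤ.≤ c × c ℤ.≤ + (l + E)

  -- The classes that meet the window. Taking representatives from the window only keeps lifted sums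
  -- bounded.
  R : Pred ℤ _
  R x = ∃[ c ] ∃[ q ] c ∈ W × x ≡ c ℤ.+ q ℤ.* + l

  W⊆R : W ⊆ R
  W⊆R {x} x∈W = x , 0ℤ , x∈W , sym (ℤ.+-identityʳ x)

  R-mod : ∀ q {x} → x ∈ R → (x ℤ.+ q ℤ.* + l) ∈ R
  R-mod q (c , q′ , c∈W , refl) = c , q′ ℤ.+ q , c∈W , collect c q′ q (+ l)
    where
    collect : ∀ c q′ q l → c ℤ.+ q′ ℤ.* l ℤ.+ q ℤ.* l ≡ c ℤ.+ (q′ ℤ.+ q) ℤ.* l
    collect = solve-∀

  small∈W : ∀ {c} → c ∈ C → ℤ.∣ c ∣ ≤ b → c ∈ W
  small∈W {c} c∈C small = c∈C
    , ℤ.≤-trans (ℤ.neg-mono-≤ (ℤ.+≤+ b≤E)) (proj₁ (∣i∣≤n⇒-n≤i≤n c small))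
    , ℤ.≤-trans (proj₂ (∣i∣≤n⇒-n≤i≤n c small)) (ℤ.+≤+ (ℕ.≤-trans b≤E (ℕ.m≤n+m E l)))
    where
    b≤E : b ≤ E
    b≤E = ℕ.m≤n+m b (N + D)

  -- Membership in `R` depends only on the class modulo l, so l decisions suffice to turn it into a
  -- Boolean function.
  module Decided (R? : ∀ (i : Fin l) → Dec (R (+ toℕ i))) where

    residue : ∀ x → Fin l
    residue x = Fin.fromℕ< (n%ℕd<d x l)

    residue-eq : ∀ x → x ≡ + toℕ (residue x) ℤ.+ (x /ℕ l) ℤ.* + l
    residue-eq x = trans (a≡a%ℕn+[a/ℕn]*n x l)
      (cong (λ z → + z ℤ.+ (x /ℕ l) ℤ.* + l) (sym (Fin.toℕ-fromℕ< (n%ℕd<d x l))))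

    dec : ∀ x → Dec (R x)
    dec x = map′ (λ r → subst R (sym (residue-eq x)) (R-mod (x /ℕ l) r))
                 (λ Rx → subst R (trans (cong (λ y → y ℤ.+ (ℤ.- (x /ℕ l)) ℤ.* + l) (residue-eq x))
                                        (cancel (+ toℕ (residue x)) (x /ℕ l) (+ l)))
                                 (R-mod (ℤ.- (x /ℕ l)) Rx))
                 (R? (residue x))
      where
      cancel : ∀ x q l → x ℤ.+ q ℤ.* l ℤ.+ (ℤ.- q) ℤ.* l ≡ x
      cancel = solve-∀

    C̄ : ℤ → Bool
    C̄ x = isYes (dec x)

    R⇒C̄ : ∀ {x} → R x → T (C̄ x)
    R⇒C̄ {x} = fromWitness {a? = dec x}

    C̄⇒R : ∀ {x} → T (C̄ x) → R x
    C̄⇒R {x} = toWitness {a? = dec x}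

    C̄-periodic : Periodic l C̄
    C̄-periodic x = begin
      isYes (dec (x ℤ.+ + l))   ≡⟨ isYes≗does (dec (x ℤ.+ + l)) ⟩
      does (dec (x ℤ.+ + l))    ≡⟨ does-⇔ (mk⇔ down up) (dec (x ℤ.+ + l)) (dec x) ⟩
      does (dec x)              ≡⟨ isYes≗does (dec x) ⟨
      isYes (dec x)             ∎
      where
      open ≡-Reasoning
      up : R x → R (x ℤ.+ + l)
      up Rx = subst (λ y → R (x ℤ.+ y)) (ℤ.*-identityˡ (+ l)) (R-mod 1ℤ Rx)
      cancel : ∀ x l → x ℤ.+ l ℤ.+ (ℤ.- 1ℤ) ℤ.* l ≡ x
      cancel = solve-∀
      down : R (x ℤ.+ + l) → R x
      down Rx = subst R (cancel x (+ l)) (R-mod (ℤ.- 1ℤ) Rx)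

    -- The element N + i - t is at least -D and at most l + N, hence in the window.
    window-hit : ∀ (i : Fin l) {t} → t ≤ D → (+ (N + toℕ i) ℤ.- + t) ∈ C →
                 T (C̄ (+ toℕ i ℤ.+ (+ N ℤ.- + t)))
    window-hit i {t} t≤D c∈C = R⇒C̄ (W⊆R (subst W (rearrange (+ N) (+ toℕ i) (+ t)) (c∈C , low , high)))
      where
      rearrange : ∀ n i t → n ℤ.+ i ℤ.- t ≡ i ℤ.+ (n ℤ.- t)
      rearrange = solve-∀
      low : ℤ.- + E ℤ.≤ + (N + toℕ i) ℤ.- + t
      low = ℤ.≤-trans (ℤ.neg-mono-≤ (ℤ.+≤+ (ℕ.≤-trans t≤D (ℕ.≤-trans (ℕ.m≤n+m D N) (ℕ.m≤m+n (N + D) b)))))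
                      (ℤ.i≤j+i (ℤ.- + t) (+ (N + toℕ i)))
      high : + (N + toℕ i) ℤ.- + t ℤ.≤ + (l + E)
      high = ℤ.≤-trans (ℤ.i≤j⇒i-k≤j (+ t) (ℤ.≤-refl {+ (N + toℕ i)}))
        (ℤ.+≤+ (subst (_≤ l + E) (ℕ.+-comm (toℕ i) N)
          (ℕ.+-mono-≤ (ℕ.<⇒≤ (Fin.toℕ<n i)) (ℕ.≤-trans (ℕ.m≤m+n N D) (ℕ.m≤m+n (N + D) b)))))

    -- Every class lies in one of the D + 1 translates of `C̄` by t - N, and these all have the size
    -- of `C̄`.
    C̄-dense : l ≤ suc D * count l C̄
    C̄-dense = begin
      l                                                        ≡⟨ trans (sum-const l 1) (ℕ.*-identityʳ l) ⟨
      ℕ∑.sum {l} (λ _ → 1)                                     ≤⟨ sum-mono l covered ⟩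
      ∑ l (λ x → ℕ∑.sum (λ t → 𝟙 (C̄ (x ℤ.+ off t))))           ≡⟨ ℕ∑.∑-comm {l} {suc D} (λ i t → 𝟙 (C̄ (+ toℕ i ℤ.+ off t))) ⟩
      ℕ∑.sum (λ t → count l (λ x → C̄ (x ℤ.+ off t)))           ≡⟨ ℕ∑.sum-cong-≗ {suc D} {λ t → count l (λ x → C̄ (x ℤ.+ off t))} (λ t → ∑-shift {f = 𝟙 ∘ C̄} (λ x → cong 𝟙 (C̄-periodic x)) (off t)) ⟩
      ℕ∑.sum {suc D} (λ _ → count l C̄)                         ≡⟨ sum-const (suc D) (count l C̄) ⟩
      suc D * count l C̄                                        ∎
      where
      open ℕ.≤-Reasoning
      off : Fin (suc D) → ℤ
      off t = + N ℤ.- + toℕ t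
      -- The inequality is decidable, which removes the double negation of `syndetic`.
      covered : ∀ i → 1 ≤ ℕ∑.sum (λ t → 𝟙 (C̄ (+ toℕ i ℤ.+ off t)))
      covered i = decidable-stable (1 ℕ.≤? _) λ ¬covered →
        syndetic (N + toℕ i) (ℕ.m≤m+n N (toℕ i)) λ (t , t≤D , c∈C) →
          ¬covered (ℕ.≤-trans
            (T⇒1≤𝟙 (subst (λ t → T (C̄ (+ toℕ i ℤ.+ (+ N ℤ.- + t)))) (sym (Fin.toℕ-fromℕ< (s≤s t≤D)))
                          (window-hit i t≤D c∈C)))
            (term≤sum (λ t → 𝟙 (C̄ (+ toℕ i ℤ.+ off t))) (Fin.fromℕ< (s≤s t≤D))))

    private
      bounded⊆ : ∀ x → x ∈ C × ℤ.∣ x ∣ ≤ b → T (C̄ x)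
      bounded⊆ x (c∈C , small) = R⇒C̄ (W⊆R (small∈W c∈C small))

    all-sums : ∀ x → ¬ ¬ (x ∈ (suc (2 * D) + suc (2 * D)) · (T ∘ C̄))
    all-sums = Growth.everything-is-a-sum l C̄ C̄-periodic (bounded⊆ 0ℤ (0∈C , z≤n)) r u
      (·-mono (λ {x} → bounded⊆ x) r u∈) (·-mono (λ {x} → bounded⊆ x) r u+1∈) D C̄-dense

    -- Each summand is replaced by a representative in the window. The window bounds add up, and `q`
    -- collects the multiples of l.
    lift-sum : ∀ j {x} → x ∈ j · (T ∘ C̄) →
      ∃[ s ] ∃[ q ] s ∈ j · C × ℤ.- + (j * E) ℤ.≤ s × s ℤ.≤ + (j * (l + E)) × x ≡ s ℤ.+ q ℤ.* + l
    lift-sum = ·-rec {A = T ∘ C̄} _ (0ℤ , 0ℤ , ·-multiple {A = C} 0∈C 0 , ℤ.≤-refl , ℤ.≤-refl , refl) step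
      where
      collect : ∀ c q s q′ l → c ℤ.+ q ℤ.* l ℤ.+ (s ℤ.+ q′ ℤ.* l) ≡ c ℤ.+ s ℤ.+ (q ℤ.+ q′) ℤ.* l
      collect = solve-∀
      step : ∀ j {x y} → T (C̄ x) → _ → _ → _
      step j x∈C̄ _ (s , q′ , s∈ , low , high , refl) with C̄⇒R x∈C̄
      ... | c , q , (c∈C , low′ , high′) , refl =
        c ℤ.+ s , q ℤ.+ q′ , ·-cons {A = C} j c∈C s∈
        , subst (ℤ._≤ c ℤ.+ s) (sym (ℤ.neg-distrib-+ (+ E) (+ (j * E)))) (ℤ.+-mono-≤ low′ low)
        , ℤ.+-mono-≤ high′ high , collect c q s q′ (+ l)

  all-lifts : ∀ x → ¬ ¬ (let k = suc (2 * D) + suc (2 * D) in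
    ∃[ s ] ∃[ q ] s ∈ k · C × ℤ.- + (k * E) ℤ.≤ s × s ℤ.≤ + (k * (l + E)) × x ≡ s ℤ.+ q ℤ.* + l)
  -- Excluded middle for each of the l classes holds under a double negation, and finitely many
  -- double negations can be combined into one.
  all-lifts x ¬lift = Fin.sequence (RawMonad.rawApplicative ¬¬-Monad) (λ _ → ¬¬-excluded-middle)
    λ R? → let open Decided R? in all-sums x (¬lift ∘ lift-sum _)

-- From classes modulo l back to integers.

module Lift (C : Pred ℤ ℓ) (0∈C : 0ℤ ∈ C) (D N : ℕ)
            (syndetic : ∀ m → N ≤ m → ¬ ¬ (∃[ t ] t ≤ D × (+ m ℤ.- + t) ∈ C))
            (r : ℕ) (u : ℤ) (b : ℕ)
            (u∈ : u ∈ r · (λ c → c ∈ C × ℤ.∣ c ∣ ≤ b))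
            (u+1∈ : (u ℤ.+ 1ℤ) ∈ r · (λ c → c ∈ C × ℤ.∣ c ∣ ≤ b))
  where

  private
    E k : ℕ
    E = N + D + b
    k = suc (2 * D) + suc (2 * D)

    -- As q l = n - s, the bounds on s place q l between n - k(l + E) ≥ 0 and n + k E < (k + 1) l.
    q-bounds : ∀ l .{{_ : NonZero l}} n s q → k * (l + E) ≤ n → n + k * E < suc k * l →
      ℤ.- + (k * E) ℤ.≤ s → s ℤ.≤ + (k * (l + E)) → + n ≡ s ℤ.+ q ℤ.* + l →
      0ℤ ℤ.≤ q × q ℤ.< + suc k
    q-bounds l n s q below above low high eq =
      -- Nonnegativity of q is obtained as -1 < q, by cancelling l in -l < 0 ≤ q l.
      ℤ.i<j⇒suc[i]≤j (ℤ.*-cancelʳ-<-nonNeg { -[1+ 0 ]} (+ l) (ℤ.<-≤-trans -l<0 0≤ql)) ,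
      ℤ.*-cancelʳ-<-nonNeg (+ l) ql<
      where
      cancel : ∀ s x → x ≡ s ℤ.+ x ℤ.- s
      cancel = solve-∀
      ql≡n-s : q ℤ.* + l ≡ + n ℤ.- s
      ql≡n-s = trans (cancel s (q ℤ.* + l)) (cong (ℤ._- s) (sym eq))
      -l<0 : -[1+ 0 ] ℤ.* + l ℤ.< 0ℤ
      -l<0 = subst (ℤ._< 0ℤ) (sym (ℤ.-1*i≡-i (+ l))) (ℤ.neg-mono-< (ℤ.+<+ (>-nonZero⁻¹ l)))
      0≤ql : 0ℤ ℤ.≤ q ℤ.* + l
      0≤ql = subst (0ℤ ℤ.≤_) (sym ql≡n-s) (ℤ.i≤j⇒0≤j-i (ℤ.≤-trans high (ℤ.+≤+ below)))
      ql< : q ℤ.* + l ℤ.< + suc k ℤ.* + l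
      ql< = begin-strict
        q ℤ.* + l                        ≡⟨ ql≡n-s ⟩
        + n ℤ.- s                        ≤⟨ ℤ.+-monoʳ-≤ (+ n) (ℤ.neg-mono-≤ low) ⟩
        + n ℤ.+ ℤ.- (ℤ.- + (k * E))      ≡⟨ cong (λ z → + n ℤ.+ z) (ℤ.neg-involutive (+ (k * E))) ⟩
        + (n + k * E)                    <⟨ ℤ.+<+ above ⟩
        + (suc k * l)                    ≡⟨ ℤ.pos-* (suc k) l ⟩
        + suc k ℤ.* + l                  ∎
        where open ℤ.≤-Reasoning

    -- Here n = s + q l with 0 ≤ q ≤ k: besides the k summands of s there are q copies of l and k -
    -- q zeros.
    lift-at : ∀ l .{{_ : NonZero l}} n → + l ∈ C → k * (l + E) ≤ n → n + k * E < suc k * l →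
              ¬ ¬ (+ n ∈ (k + k) · C)
    lift-at l n l∈C below above ¬n∈ =
      Window.all-lifts C 0∈C D N syndetic r u b u∈ u+1∈ l (+ n) λ (s , q , s∈ , low , high , eq) →
        finish s q s∈ eq (q-bounds l n s q below above low high eq)
      where
      finish : ∀ s q → s ∈ k · C → + n ≡ s ℤ.+ q ℤ.* + l → 0ℤ ℤ.≤ q × q ℤ.< + suc k → ⊥
      finish s (+ q) s∈ eq (_ , ℤ.+<+ (s≤s q≤k)) = ¬n∈ (subst₂ (λ j x → x ∈ j · C)
        (cong (λ j → k + j) (ℕ.m+[n∸m]≡n q≤k))
        (trans (drop-0 s (+ q ℤ.* + l) (+ (k ∸ q))) (sym eq))
        (·-+ {A = C} k (q + (k ∸ q)) s∈
          (·-+ {A = C} q (k ∸ q) (·-multiple {A = C} l∈C q) (·-multiple {A = C} 0∈C (k ∸ q)))))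
        where
        drop-0 : ∀ s x j → s ℤ.+ (x ℤ.+ j ℤ.* 0ℤ) ≡ s ℤ.+ x
        drop-0 = solve-∀

    -- `slack` bounds the excess of n + k E over k l for the modulus l chosen below, so l has to
    -- exceed it. A quotient n / k of at least `threshold` ensures this and leaves room for N and D.
    slack threshold : ℕ
    slack = k * suc (E + D + E)
    threshold = E + (N + D + suc slack)

  almost-all-sums : ∃[ M ] ∀ n → M ≤ n → ¬ ¬ (+ n ∈ (k + k) · C)
  almost-all-sums = threshold * k , large
    where
    large : ∀ n → threshold * k ≤ n → ¬ ¬ (+ n ∈ (k + k) · C)
    large n M≤n ¬n∈ = syndetic p N≤p λ (t , t≤D , l∈C) → choose t t≤D l∈C
      where
      q p : ℕ
      q = n / k
      -- The condition k(l + E) ≤ n holds for every l up to n / k - E, and `syndetic` finds an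
      -- element of `C` at most D below that value.
      p = q ∸ E
      threshold≤q : threshold ≤ q
      threshold≤q = subst (_≤ q) (m*n/n≡m threshold k) (/-monoˡ-≤ k M≤n)
      E+p≡q : E + p ≡ q
      E+p≡q = ℕ.m+[n∸m]≡n (ℕ.≤-trans (ℕ.m≤m+n E _) threshold≤q)
      p-large : N + D + suc slack ≤ p
      p-large = ℕ.+-cancelˡ-≤ E _ _ (subst (threshold ≤_) (sym E+p≡q) threshold≤q)
      N≤p : N ≤ p
      N≤p = ℕ.≤-trans (ℕ.≤-trans (ℕ.m≤m+n N D) (ℕ.m≤m+n (N + D) _)) p-large
      choose : ∀ t → t ≤ D → (+ p ℤ.- + t) ∈ C → ⊥
      choose t t≤D p-t∈C = lift-at l {{>-nonZero 0<l}} n (subst C (pos-∸ t≤p) p-t∈C) below above ¬n∈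
        where
        t≤p : t ≤ p
        t≤p = ℕ.≤-trans t≤D (ℕ.≤-trans (ℕ.≤-trans (ℕ.m≤n+m D N) (ℕ.m≤m+n (N + D) _)) p-large)
        l : ℕ
        l = p ∸ t
        t+l≡p : t + l ≡ p
        t+l≡p = ℕ.m+[n∸m]≡n t≤p
        slack<l : slack < l
        slack<l = ℕ.+-cancelˡ-≤ t _ _ (begin
          t + suc slack       ≤⟨ ℕ.+-monoˡ-≤ (suc slack) (ℕ.≤-trans t≤D (ℕ.m≤n+m D N)) ⟩
          N + D + suc slack   ≤⟨ p-large ⟩
          p                   ≡⟨ t+l≡p ⟨
          t + l               ∎)
          where open ℕ.≤-Reasoning
        0<l : 0 < l
        0<l = ℕ.≤-<-trans z≤n slack<l
        q≡ : q ≡ E + (t + l)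
        q≡ = trans (sym E+p≡q) (cong (λ x → E + x) (sym t+l≡p))
        below : k * (l + E) ≤ n
        below = begin
          k * (l + E)   ≡⟨ ℕ.*-comm k _ ⟩
          (l + E) * k   ≤⟨ ℕ.*-monoˡ-≤ k (subst (l + E ≤_) (trans (rearrange E t l) (sym q≡)) (ℕ.m≤n+m (l + E) t)) ⟩
          q * k         ≤⟨ m/n*n≤m n k ⟩
          n             ∎
          where
          open ℕ.≤-Reasoning
          rearrange : ∀ E t l → t + (l + E) ≡ E + (t + l)
          rearrange = ℕ-solve-∀
        -- The remainder of n modulo k is less than k, which accounts for the `suc` in `slack`.
        above : n + k * E < suc k * l
        above = begin-strict
          n + k * E                              ≡⟨ cong (λ x → x + k * E) (m≡m%n+[m/n]*n n k) ⟩
          n % k + q * k + k * E                  <⟨ ℕ.+-monoˡ-< (k * E) (ℕ.+-monoˡ-< (q * k) (m%n<n n k)) ⟩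
          k + q * k + k * E                      ≡⟨ cong (λ x → k + x * k + k * E) q≡ ⟩
          k + (E + (t + l)) * k + k * E          ≡⟨ rearrange k E t l ⟩
          k * l + k * suc (E + t + E)            ≤⟨ ℕ.+-monoʳ-≤ (k * l) (ℕ.*-monoʳ-≤ k (s≤s (ℕ.+-monoˡ-≤ E (ℕ.+-monoʳ-≤ E t≤D)))) ⟩
          k * l + slack                          ≤⟨ ℕ.+-monoʳ-≤ (k * l) (ℕ.<⇒≤ slack<l) ⟩
          k * l + l                              ≡⟨ ℕ.+-comm (k * l) l ⟩
          suc k * l                              ∎
          where
          open ℕ.≤-Reasoning
          rearrange : ∀ k E t l → k + (E + (t + l)) * k + k * E ≡ k * l + k * suc (E + t + E)
          rearrange = ℕ-solve-∀

-- Sumsets of translated sets.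

·-translate : {A : Pred ℤ ℓ} {B : Pred ℤ ℓ′} → ∀ v → (∀ {a} → a ∈ A → (a ℤ.+ v) ∈ B) →
              ∀ j {s} → s ∈ j · A → (s ℤ.+ + j ℤ.* v) ∈ j · B
·-translate {A = A} {B = B} v A+v⊆B = ·-rec {A = A} (λ j s → (s ℤ.+ + j ℤ.* v) ∈ j · B)
  ((λ ()) , (λ ()) , refl)
  λ j {a} {s} a∈A _ ih → subst (_∈ suc j · B) (rearrange a s (+ j) v) (·-cons {A = B} j (A+v⊆B a∈A) ih)
  where
  rearrange : ∀ a s j v → a ℤ.+ v ℤ.+ (s ℤ.+ j ℤ.* v) ≡ a ℤ.+ s ℤ.+ (1ℤ ℤ.+ j) ℤ.* v
  rearrange = solve-∀

-- This undoes the recentring: each of the j summands takes back its own v and expands into g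
-- elements of `B`.
·-·-translate : {B : Pred ℤ ℓ} → ∀ g v j {s} → s ∈ j · (λ c → (c ℤ.+ v) ∈ g · B) →
                (s ℤ.+ + j ℤ.* v) ∈ (j * g) · B
·-·-translate {B = B} g v = ·-rec {A = λ c → (c ℤ.+ v) ∈ g · B} (λ j s → (s ℤ.+ + j ℤ.* v) ∈ (j * g) · B)
  ((λ ()) , (λ ()) , refl)
  λ j {a} {s} a∈ _ ih → subst (_∈ (suc j * g) · B) (rearrange a s (+ j) v) (·-+ {A = B} g (j * g) a∈ ih)
  where
  rearrange : ∀ a s j v → a ℤ.+ v ℤ.+ (s ℤ.+ j ℤ.* v) ≡ a ℤ.+ s ℤ.+ (1ℤ ℤ.+ j) ℤ.* v
  rearrange = solve-∀

-- The offsets of the individual summands add up.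
·-translate-within : {A : Pred ℤ ℓ} {B : Pred ℤ ℓ′} → ∀ v μ →
  (∀ {a} → a ∈ A → ∃[ t ] t ≤ μ × (a ℤ.+ v ℤ.- + t) ∈ B) →
  ∀ j {s} → s ∈ j · A → ∃[ t ] t ≤ j * μ × (s ℤ.+ + j ℤ.* v ℤ.- + t) ∈ j · B
·-translate-within {A = A} {B = B} v μ A+v-t⊆B =
  ·-rec {A = A} (λ j s → ∃[ t ] t ≤ j * μ × (s ℤ.+ + j ℤ.* v ℤ.- + t) ∈ j · B)
    (0 , z≤n , (λ ()) , (λ ()) , refl)
    λ j {a} {s} a∈A _ (t′ , t′≤ , ih) → let t , t≤μ , ∈B = A+v-t⊆B a∈A in
      t + t′ , ℕ.+-mono-≤ t≤μ t′≤ ,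
      subst (_∈ suc j · B) (rearrange a s (+ j) v (+ t) (+ t′)) (·-cons {A = B} j ∈B ih)
  where
  rearrange : ∀ a s j v t t′ → a ℤ.+ v ℤ.- t ℤ.+ (s ℤ.+ j ℤ.* v ℤ.- t′) ≡
                               a ℤ.+ s ℤ.+ (1ℤ ℤ.+ j) ℤ.* v ℤ.- (t ℤ.+ t′)
  rearrange = solve-∀

-- Almost all and all sufficiently large numbers.

∈⇒≤sum : ∀ {n xs} → n List.∈ xs → n ≤ sum xs
∈⇒≤sum {xs = x ∷ xs} (here refl)  = ℕ.m≤m+n x (sum xs)
∈⇒≤sum {xs = x ∷ xs} (there n∈xs) = ℕ.≤-trans (∈⇒≤sum n∈xs) (ℕ.m≤n+m (sum xs) x)

-- A number beyond the sum of the list is not in the list, so it cannot be missing from `S`.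
containsAlmostAll⇒eventually : {S : Pred ℤ ℓ} → ContainsAlmostAllℕ S → ∃[ N ] ∀ n → N ≤ n → ¬ ¬ (+ n ∈ S)
containsAlmostAll⇒eventually (xs , missing⊆xs) =
  suc (sum xs) , λ n N≤n n∉S → ℕ.<⇒≱ N≤n (∈⇒≤sum (missing⊆xs n∉S))

eventually⇒containsAlmostAll : {S : Pred ℤ ℓ} → (∃[ N ] ∀ n → N ≤ n → ¬ ¬ (+ n ∈ S)) → ContainsAlmostAllℕ S
eventually⇒containsAlmostAll (N , ev) = upTo N , λ {n} n∉S → ∈-upTo⁺ (ℕ.≰⇒> λ N≤n → ev n N≤n n∉S)

-- Needed for recentring: translation by w moves a threshold by at most |w|.
large-difference : ∀ M w m → M + ℤ.∣ w ∣ ≤ m → ∃[ n ] M ≤ n × + n ≡ + m ℤ.- w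
large-difference M w m large = ℤ.∣ + m ℤ.- w ∣ , ℤ.drop‿+≤+ (subst (+ M ℤ.≤_) (sym eq) M≤) , eq
  where
  M≤ : + M ℤ.≤ + m ℤ.- w
  M≤ = begin
    + M                              ≡⟨ cong +_ (ℕ.m+n∸n≡m M ℤ.∣ w ∣) ⟨
    + (M + ℤ.∣ w ∣ ∸ ℤ.∣ w ∣)        ≡⟨ pos-∸ (ℕ.m≤n+m ℤ.∣ w ∣ M) ⟨
    + (M + ℤ.∣ w ∣) ℤ.- + ℤ.∣ w ∣    ≤⟨ ℤ.+-mono-≤ (ℤ.+≤+ large) (ℤ.neg-mono-≤ (proj₂ (∣i∣≤n⇒-n≤i≤n w ℕ.≤-refl))) ⟩
    + m ℤ.- w                        ∎
    where open ℤ.≤-Reasoning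
  eq : + ℤ.∣ + m ℤ.- w ∣ ≡ + m ℤ.- w
  eq = ℤ.0≤i⇒+∣i∣≡i (ℤ.≤-trans (ℤ.+≤+ z≤n) M≤)

-- Offsets within a finite set.

least : List⁺ ℤ → ℤ
least (x ∷ xs) = min x xs

offset≤diam : ∀ X {z} → z ∈ ⟦ X ⟧ → ∃[ t ] t ≤ diam X × z ℤ.- least X ≡ + t
offset≤diam (x ∷ xs) {z} z∈X = ℤ.∣ z ℤ.- min x xs ∣ , ℤ.drop‿+≤+ t≤ , sym z-min
  where
  min≤z : min x xs ℤ.≤ z
  min≤z = All.lookup (min≤⊤ x xs All.∷ min≤xs x xs) z∈X
  z≤max : z ℤ.≤ max x xs
  z≤max = All.lookup (⊥≤max x xs All.∷ xs≤max x xs) z∈X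
  z-min : + ℤ.∣ z ℤ.- min x xs ∣ ≡ z ℤ.- min x xs
  z-min = ℤ.0≤i⇒+∣i∣≡i (ℤ.i≤j⇒0≤j-i min≤z)
  t≤ : + ℤ.∣ z ℤ.- min x xs ∣ ℤ.≤ + diam (x ∷ xs)
  t≤ = subst₂ ℤ._≤_ (sym z-min) (sym (ℤ.0≤i⇒+∣i∣≡i (ℤ.i≤j⇒0≤j-i (ℤ.≤-trans min≤z z≤max))))
    (ℤ.+-monoˡ-≤ (ℤ.- min x xs) z≤max)

-- Exchange of `X` for y and the recentred sumset `C`.

module _ (g : ℕ) .{{_ : NonZero g}} (A : Pred ℤ ℓ) (covers : ContainsAlmostAllℕ (g · A))
         (X : List⁺ ℤ) (y : ℤ) (y∈B : y ∈ A ∖ ⟦ X ⟧)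
         (r : ℕ) (B-covers : ContainsAlmostAllℕ (r · (A ∖ ⟦ X ⟧)))
  where

  private
    B C : Pred ℤ _
    B = A ∖ ⟦ X ⟧
    C c = (c ℤ.+ + g ℤ.* y) ∈ g · B

    μ D : ℕ
    μ = diam (y ∷⁺ X)
    D = g * μ

    m₀ : ℤ
    m₀ = least (y ∷⁺ X)

    0∈C : 0ℤ ∈ C
    0∈C = subst (_∈ g · B) (sym (ℤ.+-identityˡ _)) (·-multiple {A = B} y∈B g)

    -- With g - 1 copies of y added, b becomes the sum b - y + g y of g elements of `B`.
    B-y⊆C : ∀ {b} → b ∈ B → (b ℤ.- y) ∈ C
    B-y⊆C {b} b∈B = subst₂ (λ j x → x ∈ j · B) suc-pred-g
      (trans (rearrange b y (+ pred g)) (cong (λ j → b ℤ.- y ℤ.+ + j ℤ.* y) suc-pred-g))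
      (·-cons {A = B} (pred g) b∈B (·-multiple {A = B} y∈B (pred g)))
      where
      suc-pred-g : suc (pred g) ≡ g
      suc-pred-g = ℕ.suc-pred g
      rearrange : ∀ b y p → b ℤ.+ p ℤ.* y ≡ b ℤ.- y ℤ.+ (1ℤ ℤ.+ p) ℤ.* y
      rearrange = solve-∀

    -- The offset a - m₀ turns an element of `X` into y, and the offset y - m₀ leaves any other a as
    -- it is. Both are distances from the least element of X ∪ {y}, hence between 0 and `μ`.
    exchange : ∀ {a} → a ∈ A → ∃[ t ] t ≤ μ × (a ℤ.+ (y ℤ.- m₀) ℤ.- + t) ∈ B
    exchange {a} a∈A with DecList._∈?_ ℤ._≟_ a (toList X)
    ... | yes a∈X = let t , t≤μ , eq = offset≤diam (y ∷⁺ X) (there a∈X) in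
      t , t≤μ , subst B (trans (sym (leaves-y a y m₀)) (cong (λ d → a ℤ.+ (y ℤ.- m₀) ℤ.- d) eq)) y∈B
      where
      leaves-y : ∀ a y m → a ℤ.+ (y ℤ.- m) ℤ.- (a ℤ.- m) ≡ y
      leaves-y = solve-∀
    ... | no a∉X = let t , t≤μ , eq = offset≤diam (y ∷⁺ X) (here refl) in
      t , t≤μ , subst B (trans (sym (leaves-a a (y ℤ.- m₀))) (cong (λ d → a ℤ.+ (y ℤ.- m₀) ℤ.- d) eq)) (a∈A , a∉X)
      where
      leaves-a : ∀ a d → a ℤ.+ d ℤ.- d ≡ a
      leaves-a = solve-∀

    C-syndetic : ∃[ N ] ∀ m → N ≤ m → ¬ ¬ (∃[ t ] t ≤ D × (+ m ℤ.- + t) ∈ C)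
    C-syndetic with containsAlmostAll⇒eventually {S = g · A} covers
    ... | N , ev = N + ℤ.∣ w ∣ , λ m large none →
      let n , N≤n , eq = large-difference N w m large in
      ev n N≤n λ n∈gA →
        let t , t≤D , ∈gB = ·-translate-within {A = A} {B = B} (y ℤ.- m₀) μ exchange g n∈gA in
        none (t , t≤D , subst (_∈ g · B)
          (trans (cong (λ n → n ℤ.+ + g ℤ.* (y ℤ.- m₀) ℤ.- + t) eq) (rearrange (+ m) (+ g) m₀ y (+ t))) ∈gB)
      where
      w : ℤ
      -- The exchange translates by g(y - m₀) and recentring by -g y, so m - t in `C` comes from n =
      -- m + g m₀ in the sumset of `A`.
      w = ℤ.- (+ g ℤ.* m₀)
      rearrange : ∀ m g m₀ y t → m ℤ.- (ℤ.- (g ℤ.* m₀)) ℤ.+ g ℤ.* (y ℤ.- m₀) ℤ.- t ≡ m ℤ.- t ℤ.+ g ℤ.* y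
      rearrange = solve-∀

    -- Twice k = 2(2D + 1): k summands reach the class modulo l, and k more are copies of l or
    -- zeros.
    K : ℕ
    K = suc (2 * D) + suc (2 * D) + (suc (2 * D) + suc (2 * D))

    C[_] : ℕ → Pred ℤ _
    C[ b ] c = c ∈ C × ℤ.∣ c ∣ ≤ b

    C-mono : ∀ {b b′} → b ≤ b′ → r · C[ b ] ⊆ r · C[ b′ ]
    C-mono {b} {b′} b≤b′ = ·-mono {A = C[ b ]} {B = C[ b′ ]} (λ (c∈C , c≤b) → c∈C , ℕ.≤-trans c≤b b≤b′) r

    recentred : ∀ {u} → u ∈ r · B → ∃[ b ] (u ℤ.+ + r ℤ.* (ℤ.- y)) ∈ r · C[ b ]
    recentred u∈ = ·-bounded-summands {A = C} r
      (·-translate {A = B} {B = C} (ℤ.- y) (λ {b} → B-y⊆C {b}) r u∈)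

    -- Recentring moves u and u + 1 by the same amount -r y, so they remain consecutive and serve as
    -- the generators. The sum of their two bounds is a common one.
    sums-in-C : ∀ {u} → u ∈ r · B → (u ℤ.+ 1ℤ) ∈ r · B → ∃[ M ] ∀ n → M ≤ n → ¬ ¬ (+ n ∈ K · C)
    sums-in-C {u} u∈ u+1∈ =
      let b  , v∈  = recentred u∈
          b′ , v′∈ = recentred u+1∈
      in Lift.almost-all-sums C 0∈C D (proj₁ C-syndetic) (proj₂ C-syndetic) r (u ℤ.+ + r ℤ.* (ℤ.- y)) (b + b′)
        (C-mono (ℕ.m≤m+n b b′) v∈)
        (subst (_∈ r · C[ b + b′ ]) (swap u (+ r ℤ.* (ℤ.- y))) (C-mono (ℕ.m≤n+m b′ b) v′∈))
      where
      swap : ∀ u v → u ℤ.+ 1ℤ ℤ.+ v ≡ u ℤ.+ v ℤ.+ 1ℤ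
      swap = solve-∀

  complement-covers : ¬ ¬ ContainsAlmostAllℕ ((K * g) · B)
  complement-covers k =
    let N , ev = containsAlmostAll⇒eventually {S = r · B} B-covers in
    -- Because the complement is itself a basis, two consecutive integers are sums of r of its
    -- elements.
    ev N ℕ.≤-refl λ N∈ → ev (N + 1) (ℕ.m≤m+n N 1) λ N+1∈ →
    let M , sums = sums-in-C N∈ N+1∈ in
    k (eventually⇒containsAlmostAll {S = (K * g) · B} (M + ℤ.∣ w ∣ , λ m large m∉ →
      let n , M≤n , eq = large-difference M w m large in
      sums n M≤n λ n∈KC → m∉
        (subst (_∈ (K * g) · B) (trans (cong (ℤ._+ w) eq) (cancel (+ m) w)) (·-·-translate {B = B} g (+ g ℤ.* y) K n∈KC))))
    where
    w : ℤ
    w = + K ℤ.* (+ g ℤ.* y)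
    cancel : ∀ m w → m ℤ.- w ℤ.+ w ≡ m
    cancel = solve-∀

theorem1p3 : ∀ {ℓ : Level} (h : ℕ) → 1 ≤ h →
    (A : Pred ℤ ℓ) → IsAsymptoticBasis A →
    (g : ℕ) → IsOrder A g → g ≤ h →
    (X : List⁺ ℤ) → ⟦ X ⟧ ⊆ A →
    (g′ : ℕ) → IsOrder (A ∖ ⟦ X ⟧) g′ →
    (μ : ℕ) → Isμ A X μ →
    g′ ≤ 4 * h * (2 * h * μ + 1)
theorem1p3 h 1≤h A _ (suc g) ((_ , covers) , _) g≤h X _ g′ ((_ , B-covers) , least-g′) μ ((y , y∈B , refl) , _) =
  decidable-stable (g′ ℕ.≤? _) λ g′≰ →
    complement-covers (suc g) A covers X y y∈B g′ B-covers λ complement →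
      g′≰ (ℕ.≤-trans (least-g′ _ (s≤s z≤n , complement)) bound)
  where
  -- With D = g μ the number of summands is the claimed bound with g in place of h, and the bound is
  -- monotone in h.
  expand : ∀ g μ → (suc (2 * (g * μ)) + suc (2 * (g * μ)) + (suc (2 * (g * μ)) + suc (2 * (g * μ)))) * g
                   ≡ 4 * g * (2 * g * μ + 1)
  expand = ℕ-solve-∀
  bound : _ ≤ 4 * h * (2 * h * μ + 1)
  bound = ℕ.≤-trans (ℕ.≤-reflexive (expand (suc g) μ))
    (ℕ.*-mono-≤ (ℕ.*-monoʳ-≤ 4 g≤h) (ℕ.+-monoˡ-≤ 1 (ℕ.*-monoˡ-≤ μ (ℕ.*-monoʳ-≤ 2 g≤h))))
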